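{- Let $V$ be a nonempty set (finite or infinite), let $E\subset V\times V$, and let $W\subset V$. For all vertices $b,c\in W^c=V\setminus W$ we have $$\operatorname{cl}_W\big(R_W b\big)\cap \operatorname{cl}_W\big(R_W c\big)=\emptyset \iff \neg\,\big(b\,A_W\,c\big),$$ that is, $b$ and $c$ are t-separated with respect to $W$ if and only if they are d-separated with respect to $W$.
   Context: Relations on $V$: $x\,R\,y$ means $(x,y)\in R$; the composition $RR'$ is defined by $x(RR')y$ iff there is $z\in V$ with $xRz$ and $zR'y$; $R^{ -1}$ is the converse ($xR^{ -1}y\iff yRx$); $R^0=\Delta$, $R^{n+1}=RR^n$, $R^+=\bigcup_{k\ge1}R^k$, $R^*=\bigcup_{k\ge0}R^k$. For $S\subset V$, $\Delta_S=\{(x,x):x\in S\}$ and $\Delta=\Delta_V$. For $S\subset V$, the foreset is $RS=\{x\in V:\exists s\in S,\ xRs\}$ and the afterset is $SR=\{y\in V:\exists s\in S,\ sRy\}$; for a vertex $c$, $Rc=R\{c\}$. For any relation $F$ on $V$, $\mathcal T_F=\{O\subset V: OF\subset O\}$ is a topology on $V$. Given $W\subset V$ with $W^c=V\setminus W$, define: $E_W=\Delta_{W^c}E$ (so $xE_Wy$ iff $x\in W^c$ and $xEy$); $B_W=E(E_W)^*$ and $B_W^-=(B_W)^{ -1}=(E_W^{ -1})^*E^{ -1}$; $K_W=B_W^-\Delta_{W^c}B_W$ (equivalently $(E_W^{ -1})^+(E_W)^+$); $C_W=(\Delta_WK_W\Delta_W)^+\cup\Delta_W$; $A_W=\Delta\cup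 B_W\cup B_W^-\cup K_W\cup(B_W\cup K_W)\,C_W\,(B_W^-\cup K_W^{ -1})$; $R_W=\Delta\cup C_W(B_W^-\cup K_W^{ -1})$. For $S\subset V$, $\operatorname{cl}_W(S)$ denotes the topological closure of $S$ in the topology $\mathcal T_{E_W}$. Vertices $b,c$ are called t-separated w.r.t. $W$ if $\operatorname{cl}_W(R_Wb)\cap\operatorname{cl}_W(R_Wc)=\emptyset$, and d-separated w.r.t. $W$ if $\neg(b\,A_W\,c)$. -}

module Defs where

open import Function.Base using (flip)
open import Level using (Level; suc; _⊔_)
open import Data.Product using (∃-syntax; _×_)
open import Relation.Binary.Construct.Closure.ReflexiveTransitive using (Star)
open import Relation.Binary.Construct.Closure.Transitive using (TransClosure)
open import Relation.Binary.Construct.Composition using (_;_)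
open import Relation.Binary.Construct.Union using (_∪_)
open import Relation.Binary.Core using (Rel)
open import Relation.Binary.PropositionalEquality.Core using (_≡_)
open import Relation.Nullary.Negation.Core using (¬_)
open import Relation.Unary using (Pred; _∈_; _⊆_; _≐_; _∩_; ∁; ｛_｝; Empty)

private
  variable
    ℓ : Level
    V : Set ℓ

foreset : Rel V ℓ → Pred V ℓ → Pred V _
foreset R S x = ∃[ s ] s ∈ S × R x s

afterset : Pred V ℓ → Rel V ℓ → Pred V _
afterset S R y = ∃[ s ] s ∈ S × R s y

Δ : Rel V _
Δ = _≡_

Δ[_] : Pred V ℓ → Rel V _
Δ[ S ] x y = x ∈ S × x ≡ y

-- Membership of O in the topology 𝒯_F.

IsOpen : {V : Set ℓ} → Rel V ℓ → Pred V ℓ → Set ℓ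
IsOpen F O = afterset O F ⊆ O

-- Closed sets are literally the complements of open sets; since ∁ is not
-- involutive constructively, this is not the same as asking ∁ C to be open.

IsClosed : {V : Set ℓ} → Rel V ℓ → Pred V ℓ → Set (suc ℓ)
IsClosed F C = ∃[ O ] IsOpen F O × C ≐ ∁ O

closure : {V : Set ℓ} → Rel V ℓ → Pred V ℓ → Pred V (suc ℓ)
closure F S x = ∀ C → IsClosed F C → S ⊆ C → x ∈ C

module _ {V : Set ℓ} (E : Rel V ℓ) (W : Pred V ℓ) where

  E[W] : Rel V ℓ
  E[W] = Δ[ ∁ W ] ; E

  B : Rel V ℓ
  B = E ; Star E[W]

  B⁻ : Rel V ℓ
  B⁻ = flip B

  K : Rel V ℓ
  K = B⁻ ; Δ[ ∁ W ] ; B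

  K⁻ : Rel V ℓ
  K⁻ = flip K

  C : Rel V ℓ
  C = TransClosure (Δ[ W ] ; K ; Δ[ W ]) ∪ Δ[ W ]

  A : Rel V ℓ
  A = Δ ∪ B ∪ B⁻ ∪ K ∪ ((B ∪ K) ; C ; (B⁻ ∪ K⁻))

  R : Rel V ℓ
  R = Δ ∪ (C ; (B⁻ ∪ K⁻))

  cl : Pred V ℓ → Pred V (suc ℓ)
  cl = closure E[W]

  TSeparated : Rel V (suc ℓ)
  TSeparated b c = Empty (cl (foreset R ｛ b ｝) ∩ cl (foreset R ｛ c ｝))

  DSeparated : Rel V ℓ
  DSeparated b c = ¬ A b c

{-# OPTIONS --safe #-}

-- Up to double negation, cl_W S is the set of E_W-ancestors of S, so b and c
-- fail to be t-separated exactly when E_W-paths lead from a common vertex x to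
-- some s ∈ R_W b and some t ∈ R_W c.  An E_W-path leaves x only if x ∉ W, and
-- every element of R_W b other than b lies in W; splitting on whether the two
-- paths are trivial therefore gives the clauses of A_W one by one.
module Submission where

open import Defs
open import Data.Product using (_×_; _,_; ∃-syntax)
open import Data.Sum using (_⊎_; inj₁; inj₂)
open import Function.Bundles using (_⇔_; mk⇔)
open import Level using (Level)
open import Relation.Binary.Construct.Closure.ReflexiveTransitive using (Star; ε; _◅_)
open import Relation.Binary.Construct.Closure.Transitive
  using ([_]; _∷_; _++_; symmetric)
open import Relation.Binary.Construct.Composition using (_;_)
open import Relation.Binary.Construct.Union using (_∪_)
open import Relation.Binary.Core using (Rel)
open import Relation.Binary.Definitions using (Symmetric; Transitive)
open import Relation.Binary.PropositionalEquality.Core using (_≡_; refl; sym)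
open import Relation.Nullary.Negation.Core using (contradiction)
open import Relation.Unary using (Pred; _∈_; _⊆_; ∁; ｛_｝)

private
  variable
    ℓ : Level

module _ {V : Set ℓ} (F : Rel V ℓ) (S : Pred V ℓ) where

  -- Open sets are carried forward along `F`-paths: if `x` lay in the open complement of `D`, then
  -- so would the endpoint `s`, although `s` is in `S`.
  foreset-star⊆closure : foreset (Star F) S ⊆ closure F S
  foreset-star⊆closure (s , s∈S , x⟶s) D (O , open-O , D⊆∁O , ∁O⊆D) S⊆D =
    ∁O⊆D λ x∈O → D⊆∁O (S⊆D s∈S) (along x⟶s x∈O)
    where
    along : ∀ {x y} → Star F x y → x ∈ O → y ∈ O
    along ε          x∈O = x∈O
    along (xFz ◅ z⟶y) x∈O = along z⟶y (open-O (_ , x∈O , xFz))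

  -- The non-ancestors of `S` form an open set, since an `F`-step into an ancestor starts at an
  -- ancestor. The complement of that set is closed and contains `S`, but membership in it gives
  -- ancestry only up to double negation.
  closure⊆¬¬foreset-star : closure F S ⊆ ∁ (∁ (foreset (Star F) S))
  closure⊆¬¬foreset-star x∈cl = x∈cl (∁ (∁ (foreset (Star F) S)))
    ( ∁ (foreset (Star F) S)
    , (λ (s , s∉ , sFy) (t , t∈S , y⟶t) → s∉ (t , t∈S , sFy ◅ y⟶t))
    , (λ p → p) , (λ p → p) )
    (λ s∈S ¬fs → ¬fs (_ , s∈S , ε))

module _ {V : Set ℓ} (E : Rel V ℓ) (W : Pred V ℓ) where

  private
    F = E[W] E W
    L = B E W ∪ K E W
    L⁻ = B⁻ E W ∪ K⁻ E W

  star⇒≡⊎B : ∀ {x y} → Star F x y → x ≡ y ⊎ (x ∈ ∁ W × B E W x y)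
  star⇒≡⊎B ε = inj₁ refl
  star⇒≡⊎B ((_ , (x∉W , refl) , xEz) ◅ z⟶y) = inj₂ (x∉W , _ , xEz , z⟶y)

  -- The first edge of `B` is an unguarded `E`-edge, so the source must supply the guard of `F`.
  B⇒star : ∀ {x y} → x ∈ ∁ W → B E W x y → Star F x y
  B⇒star x∉W (_ , xEz , z⟶y) = (_ , (x∉W , refl) , xEz) ◅ z⟶y

  K-intro : ∀ {x y z} → z ∈ ∁ W → B E W z x → B E W z y → K E W x y
  K-intro z∉W zBx zBy = _ , zBx , _ , (z∉W , refl) , zBy

  K-sym : Symmetric (K E W)
  K-sym (_ , zBx , _ , (z∉W , refl) , zBy) = K-intro z∉W zBy zBx

  C-intro : ∀ {x y} → x ∈ W → y ∈ W → K E W x y → C E W x y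
  C-intro x∈W y∈W xKy = inj₁ [ _ , (x∈W , refl) , _ , xKy , (y∈W , refl) ]

  C-sym : Symmetric (C E W)
  C-sym (inj₁ xCy) = inj₁ (symmetric _ WKW-sym xCy)
    where
    WKW-sym : Symmetric (Δ[ W ] ; K E W ; Δ[ W ])
    WKW-sym (_ , (x∈W , refl) , _ , xKy , (y∈W , refl)) =
      _ , (y∈W , refl) , _ , K-sym xKy , (x∈W , refl)
  C-sym (inj₂ (x∈W , refl)) = inj₂ (x∈W , refl)

  C-trans : Transitive (C E W)
  C-trans (inj₁ xCy)       (inj₁ yCz)       = inj₁ (xCy ++ yCz)
  C-trans xCy              (inj₂ (_ , refl)) = xCy
  C-trans (inj₂ (_ , refl)) yCz              = yCz

  C⇒∈W : ∀ {x y} → C E W x y → x ∈ W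
  C⇒∈W (inj₁ [ _ , (x∈W , refl) , _ ])     = x∈W
  C⇒∈W (inj₁ ((_ , (x∈W , refl) , _) ∷ _)) = x∈W
  C⇒∈W (inj₂ (x∈W , _))                    = x∈W

  A-sym : Symmetric (A E W)
  A-sym (inj₁ x≡y)                      = inj₁ (sym x≡y)
  A-sym (inj₂ (inj₁ xBy))               = inj₂ (inj₂ (inj₁ xBy))
  A-sym (inj₂ (inj₂ (inj₁ yBx)))        = inj₂ (inj₁ yBx)
  A-sym (inj₂ (inj₂ (inj₂ (inj₁ xKy)))) = inj₂ (inj₂ (inj₂ (inj₁ (K-sym xKy))))
  -- `L⁻` unfolds to the converse of `L`, so the two outer links swap roles unchanged.
  A-sym (inj₂ (inj₂ (inj₂ (inj₂ (_ , xLw , _ , wCw′ , w′L⁻y))))) =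
    inj₂ (inj₂ (inj₂ (inj₂ (_ , w′L⁻y , _ , C-sym wCw′ , xLw))))

  LCL⁻⇒A : ∀ {b t c} → L b t → (C E W ; L⁻) t c → A E W b c
  LCL⁻⇒A bLt tCL⁻c = inj₂ (inj₂ (inj₂ (inj₂ (_ , bLt , tCL⁻c))))

  -- A positive form of the failure of t-separation, with each closure replaced by the ancestor set
  -- that it equals up to double negation.
  Joined : Rel V ℓ
  Joined b c = ∃[ x ] x ∈ foreset (Star F) (foreset (R E W) ｛ b ｝)
                    × x ∈ foreset (Star F) (foreset (R E W) ｛ c ｝)

  joined : ∀ {x s t b c} → Star F x s → R E W s b → Star F x t → R E W t c →
           Joined b c
  joined x⟶s sRb x⟶t tRc =
    _ , (_ , (_ , refl , sRb) , x⟶s) , (_ , (_ , refl , tRc) , x⟶t)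

  -- Since `t` is in `W`, the path to `t` cannot be trivial: `x` would then be `t`, yet `x` is
  -- either `b` or the source of an `F`-step, hence outside `W`.
  fork⇒L : ∀ {x b t} → b ∈ ∁ W → t ∈ W → Star F x b → Star F x t → L b t
  fork⇒L b∉W t∈W x⟶b x⟶t with star⇒≡⊎B x⟶b | star⇒≡⊎B x⟶t
  ... | inj₁ refl        | inj₁ refl        = contradiction t∈W b∉W
  ... | inj₁ refl        | inj₂ (_ , bBt)   = inj₁ bBt
  ... | inj₂ (x∉W , _)   | inj₁ refl        = contradiction t∈W x∉W
  ... | inj₂ (x∉W , xBb) | inj₂ (_ , xBt)   = inj₂ (K-intro x∉W xBb xBt)

  -- With both ends in `W`, the paths are trivial together or not at all; the trivial case is what
  -- the diagonal part of `C` absorbs.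
  fork⇒C : ∀ {x s t} → s ∈ W → t ∈ W → Star F x s → Star F x t → C E W s t
  fork⇒C s∈W t∈W x⟶s x⟶t with star⇒≡⊎B x⟶s | star⇒≡⊎B x⟶t
  ... | inj₁ refl        | inj₁ refl      = inj₂ (s∈W , refl)
  ... | inj₁ refl        | inj₂ (s∉W , _) = contradiction s∈W s∉W
  ... | inj₂ (x∉W , _)   | inj₁ refl      = contradiction t∈W x∉W
  ... | inj₂ (x∉W , xBs) | inj₂ (_ , xBt) = C-intro s∈W t∈W (K-intro x∉W xBs xBt)

  fork⇒A : ∀ {x b c} → Star F x b → Star F x c → A E W b c
  fork⇒A x⟶b x⟶c with star⇒≡⊎B x⟶b | star⇒≡⊎B x⟶c
  ... | inj₁ refl        | inj₁ refl      = inj₁ refl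
  ... | inj₁ refl        | inj₂ (_ , bBc) = inj₂ (inj₁ bBc)
  ... | inj₂ (_ , cBb)   | inj₁ refl      = inj₂ (inj₂ (inj₁ cBb))
  ... | inj₂ (x∉W , xBb) | inj₂ (_ , xBc) =
    inj₂ (inj₂ (inj₂ (inj₁ (K-intro x∉W xBb xBc))))

  Joined⇒A : ∀ {b c} → b ∈ ∁ W → c ∈ ∁ W → Joined b c → A E W b c
  Joined⇒A b∉W c∉W (_ , (_ , (_ , refl , sRb) , x⟶s) , (_ , (_ , refl , tRc) , x⟶t))
    with sRb | tRc
  ... | inj₁ refl | inj₁ refl = fork⇒A x⟶s x⟶t
  ... | inj₁ refl | inj₂ tCL⁻c@(_ , tCw , _) =
    LCL⁻⇒A (fork⇒L b∉W (C⇒∈W tCw) x⟶s x⟶t) tCL⁻c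
  ... | inj₂ sCL⁻b@(_ , sCw , _) | inj₁ refl =
    A-sym (LCL⁻⇒A (fork⇒L c∉W (C⇒∈W sCw) x⟶t x⟶s) sCL⁻b)
  -- The fork links `s` to `t` by `C`, so the chain `w`, `s`, `t`, `w′` collapses to one `C`-link.
  ... | inj₂ (_ , sCw , wL⁻b) | inj₂ (_ , tCw′ , w′L⁻c) =
    LCL⁻⇒A wL⁻b (_ , C-trans (C-sym sCw) (C-trans sCt tCw′) , w′L⁻c)
    where sCt = fork⇒C (C⇒∈W sCw) (C⇒∈W tCw′) x⟶s x⟶t

  -- Every clause is realised with `b` itself as the endpoint on the left. On the right `c` serves
  -- too, except in the last clause, whose tail `C ; L⁻` is the nontrivial part of `R`.
  A⇒Joined : ∀ {b c} → b ∈ ∁ W → c ∈ ∁ W → A E W b c → Joined b c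
  A⇒Joined b∉W c∉W (inj₁ refl) = joined ε (inj₁ refl) ε (inj₁ refl)
  A⇒Joined b∉W c∉W (inj₂ (inj₁ bBc)) =
    joined ε (inj₁ refl) (B⇒star b∉W bBc) (inj₁ refl)
  A⇒Joined b∉W c∉W (inj₂ (inj₂ (inj₁ cBb))) =
    joined (B⇒star c∉W cBb) (inj₁ refl) ε (inj₁ refl)
  A⇒Joined b∉W c∉W (inj₂ (inj₂ (inj₂ (inj₁ (_ , zBb , _ , (z∉W , refl) , zBc))))) =
    joined (B⇒star z∉W zBb) (inj₁ refl) (B⇒star z∉W zBc) (inj₁ refl)
  A⇒Joined b∉W c∉W (inj₂ (inj₂ (inj₂ (inj₂ (_ , inj₁ bBt , tCL⁻c))))) =
    joined ε (inj₁ refl) (B⇒star b∉W bBt) (inj₂ tCL⁻c)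
  A⇒Joined b∉W c∉W
    (inj₂ (inj₂ (inj₂ (inj₂ (_ , inj₂ (_ , zBb , _ , (z∉W , refl) , zBt) , tCL⁻c))))) =
    joined (B⇒star z∉W zBb) (inj₁ refl) (B⇒star z∉W zBt) (inj₂ tCL⁻c)

theorem1 : ∀ {ℓ} (V : Set ℓ) → V → (E : Rel V ℓ) (W : Pred V ℓ) →
    ∀ b c → b ∈ ∁ W → c ∈ ∁ W →
    TSeparated E W b c ⇔ DSeparated E W b c
theorem1 V _ E W b c b∉W c∉W = mk⇔
  (λ t-sep bAc → let x , x⟶Rb , x⟶Rc = A⇒Joined E W b∉W c∉W bAc in
    t-sep x (foreset-star⊆closure _ _ x⟶Rb , foreset-star⊆closure _ _ x⟶Rc))
  (λ d-sep x (x∈clRb , x∈clRc) →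
    -- The goal is absurdity, so both double negations can be stripped.
    closure⊆¬¬foreset-star _ _ x∈clRb λ x⟶Rb →
    closure⊆¬¬foreset-star _ _ x∈clRc λ x⟶Rc →
    d-sep (Joined⇒A E W b∉W c∉W (x , x⟶Rb , x⟶Rc)))
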